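{- Every leapfrog fullerene graph is 2-resonant.
   Context: A fullerene graph is a 3-connected plane cubic graph with exactly 12 pentagonal faces and all other faces hexagonal. Leapfrog operation on a fullerene graph $F$: for each face $f$ of $F$, add a new vertex $v_f$ inside $f$ joined to all vertices of $f$, obtaining a plane triangulation $F'$; the leapfrog graph $F^*$ is the geometric dual of $F'$. A leapfrog fullerene graph is a fullerene graph arising from some fullerene graph by this operation. A set $\mathcal H$ of pairwise vertex-disjoint hexagonal faces of a fullerene graph $G$ is a resonant pattern if $G$ has a perfect matching $M$ such that every hexagon in $\mathcal H$ is $M$-alternating (edges alternately in and off $M$), equivalently $G$ minus all vertices of the hexagons of $\mathcal H$ has a perfect matching. $G$ is $k$-resonant if every set of $i$ pairwise disjoint hexagons, for each $0\le i\le k$, is a resonant pattern. -}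

module Defs where

open import Data.Nat using (ℕ; zero; suc; _+_; _*_; _≤_; _<_)
open import Data.Fin using (Fin; zero; suc; combine; remQuot)
open import Data.Bool using (Bool; true; false)
open import Data.Product using (Σ; ∃; _×_; _,_; proj₁)
open import Data.Sum using (_⊎_)
open import Data.List using (List; length)
open import Data.List.Membership.Propositional using (_∉_)
open import Data.List.Relation.Unary.All using (All)
open import Data.List.Relation.Unary.AllPairs using (AllPairs)
open import Relation.Binary.PropositionalEquality using (_≡_; _≢_)

-- Cubic combinatorial maps (rotation systems of cubic graphs).
-- Vertices are Fin V; each vertex has three darts (half-edges),
-- numbered 0,1,2 in the cyclic (rotation) order around the vertex.
-- The map is given by the edge involution α on darts.

Dart : ℕ → Set
Dart V = Fin V × Fin 3

vert : ∀ {V} → Dart V → Fin V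
vert = proj₁

rot : Fin 3 → Fin 3
rot zero = suc zero
rot (suc zero) = suc (suc zero)
rot (suc (suc zero)) = zero

rot⁻ : Fin 3 → Fin 3
rot⁻ zero = suc (suc zero)
rot⁻ (suc zero) = zero
rot⁻ (suc (suc zero)) = suc zero

iter : ∀ {A : Set} → (A → A) → ℕ → A → A
iter f zero x = x
iter f (suc k) x = f (iter f k x)

record CubicMap (V : ℕ) : Set where
  constructor cubic
  field
    α : Dart V → Dart V

module _ {V : ℕ} (G : CubicMap V) where
  open CubicMap G

  σ : Dart V → Dart V
  σ (v , i) = (v , rot i)

  σ⁻ : Dart V → Dart V
  σ⁻ (v , i) = (v , rot⁻ i)

  φ : Dart V → Dart V
  φ d = σ (α d)

  φ⁻ : Dart V → Dart V
  φ⁻ d = α (σ⁻ d)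

  IsMap : Set
  IsMap = (∀ d → α (α d) ≡ d) × (∀ d → α d ≢ d)

  Simple : Set
  Simple = (∀ d → vert (α d) ≢ vert d)
         × (∀ v i j → i ≢ j → vert (α (v , i)) ≢ vert (α (v , j)))

  Adj : Fin V → Fin V → Set
  Adj u w = ∃ λ i → vert (α (u , i)) ≡ w

  data Reach (S : List (Fin V)) : Fin V → Fin V → Set where
    here : ∀ {x} → x ∉ S → Reach S x x
    step : ∀ {x y z} → x ∉ S → Adj x y → Reach S y z → Reach S x z

  ThreeConnected : Set
  ThreeConnected = 4 ≤ V
    × (∀ (S : List (Fin V)) → length S ≤ 2 →
         ∀ x y → x ∉ S → y ∉ S → Reach S x y)

  SameFace : Dart V → Dart V → Set
  SameFace d e = ∃ λ k → iter φ k d ≡ e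

  FaceCount : ℕ → Set
  FaceCount F = Σ (Dart V → Fin F) λ lab →
      (∀ d → lab (φ d) ≡ lab d)
    × (∀ d e → lab d ≡ lab e → SameFace d e)
    × (∀ f → ∃ λ d → lab d ≡ f)

  -- plane (genus 0) embedding: Euler's formula V - E + F = 2,
  -- where 2E = number of darts = 3V
  Plane : Set
  Plane = ∃ λ F → FaceCount F × (2 * (V + F) ≡ 4 + 3 * V)

  FaceLen : Dart V → ℕ → Set
  FaceLen d k = 0 < k × iter φ k d ≡ d
              × (∀ j → 0 < j → j < k → iter φ j d ≢ d)

  TwelvePentagons : Set
  TwelvePentagons = Σ (Fin 12 → Dart V) λ p →
      (∀ i → FaceLen (p i) 5)
    × (∀ i j → SameFace (p i) (p j) → i ≡ j)
    × (∀ d → FaceLen d 5 → ∃ λ i → SameFace (p i) d)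

  Fullerene : Set
  Fullerene = IsMap × Simple × ThreeConnected × Plane
            × (∀ d → FaceLen d 5 ⊎ FaceLen d 6)
            × TwelvePentagons

  -- hexagonal faces, represented by any of their darts
  Hexagon : Dart V → Set
  Hexagon d = FaceLen d 6

  VDisjoint : Dart V → Dart V → Set
  VDisjoint d e = ∀ j l → vert (iter φ j d) ≢ vert (iter φ l e)

  -- perfect matching, as an α-invariant set of darts (= set of edges)
  -- covering every vertex exactly once
  PerfectMatching : (Dart V → Bool) → Set
  PerfectMatching M = (∀ d → M (α d) ≡ M d)
    × (∀ v → ∃ λ i → M (v , i) ≡ true × (∀ j → j ≢ i → M (v , j) ≡ false))

  Alternating : (Dart V → Bool) → Dart V → Set
  Alternating M d = ∀ j → M (iter φ (suc j) d) ≢ M (iter φ j d)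

  ResonantPattern : List (Dart V) → Set
  ResonantPattern H = ∃ λ M → PerfectMatching M × All (Alternating M) H

  KResonant : ℕ → Set
  KResonant k = ∀ (H : List (Dart V)) → length H ≤ k →
    All Hexagon H → AllPairs VDisjoint H → ResonantPattern H

-- Leapfrog.  Vertices of the leapfrog are the triangles of the
-- omnicapped triangulation F', which correspond to darts d of F
-- (triangle formed by the edge of d and the centre of the face of d),
-- encoded in Fin (V * 3).  The triangle of d is adjacent to those of
-- α d (across the original edge), φ⁻ d and φ d (across the spokes);
-- these are its darts 0, 1, 2 in rotation order.

module _ {V : ℕ} (G : CubicMap V) where
  open CubicMap G

  enc : Dart V → Fin (V * 3)
  enc (v , i) = combine v i

  dec : Fin (V * 3) → Dart V
  dec x = remQuot 3 x

  leapα : Dart (V * 3) → Dart (V * 3)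
  leapα (x , zero) = (enc (α (dec x)) , zero)
  leapα (x , suc zero) = (enc (φ⁻ G (dec x)) , suc (suc zero))
  leapα (x , suc (suc zero)) = (enc (φ G (dec x)) , suc zero)

  leapfrog : CubicMap (V * 3)
  leapfrog = cubic leapα

module Submission where

-- Taking all edges of the original graph G gives a perfect matching of its leapfrog in
-- which every hexagon around a vertex of G alternates, and the hexagons around the vertices
-- of an independent set S may be flipped.  A hexagon coming from a face of G alternates
-- after the flip as soon as S contains every other vertex of that face, so it suffices to
-- choose, for two hexagonal faces (or a face and a vertex), alternate vertices on each whose
-- union is independent.  If none of the four choices works, the graph has a closed walk of
-- length at most 5 that is neither degenerate nor a pentagonal face.  Such walks are
-- excluded because a chordless cycle of length at most 5 bounds a face: by Euler's formula it is
-- the boundary of a set of faces, and on one of its sides at most two cycle vertices have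
-- their third edge, so 3-connectedness leaves nothing on that side.

open import Defs
open import Data.Nat as ℕ using (ℕ; zero; suc; _+_; _*_; _≤_; _<_; _^_; z≤n; s≤s)
import Data.Nat.Properties as ℕₚ
open import Data.Nat.Tactic.RingSolver using (solve-∀)
open import Data.Fin as Fin using (Fin; zero; suc; combine; finToFun; funToFin)
import Data.Fin.Properties as Finₚ
open import Data.Bool using (Bool; true; false; not; _∧_; _∨_; _xor_)
import Data.Bool.Properties as Boolₚ
open import Data.Bool.Solver using (module xor-∧-Solver)
open import Data.Empty using (⊥; ⊥-elim)
open import Data.List as List using (List; []; _∷_; _++_; length; filter)
import Data.List.Properties as Listₚ
import Data.List.Membership.DecPropositional as DecMembership
open import Data.List.Membership.Propositional using (_∈_; _∉_)
open import Data.List.Membership.Propositional.Properties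
  using (∈-tabulate⁺; ∈-tabulate⁻; ∈-filter⁺; ∈-filter⁻; ∈-++⁺ˡ; ∈-++⁺ʳ; ∈-++⁻)
open import Data.List.Relation.Unary.All using ([]; _∷_)
open import Data.List.Relation.Unary.Any using (here)
open import Data.Product using (∃; ∃₂; _×_; _,_; proj₁; proj₂)
import Data.Product.Properties as ×ₚ
open import Data.Product.Function.NonDependent.Propositional using (_×-↔_)
open import Data.Sum using (_⊎_; inj₁; inj₂; [_,_]′)
open import Data.Sum.Function.Propositional using (_⊎-↔_)
open import Data.Vec as Vec using (Vec; []; _∷_; lookup)
import Data.Vec.Properties as Vecₚ
open import Data.Vec.Relation.Unary.All using ([]; _∷_)
open import Data.Vec.Relation.Unary.AllPairs using ([]; _∷_)
open import Data.Vec.Relation.Unary.Unique.Propositional using (Unique)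
open import Data.Vec.Relation.Unary.Unique.Propositional.Properties using (lookup-injective)
open import Function using (_∘_; _↔_; Inverse; mk⇔)
open import Function.Properties.Inverse using (↔-refl; ↔-trans)
open import Relation.Binary.Definitions using (DecidableEquality)
open import Relation.Binary.PropositionalEquality
open import Relation.Nullary using (¬_; Dec; yes; no; does; contradiction; _⊎-dec_; ¬?)
open import Relation.Nullary.Decidable
  using (True; toWitness; from-yes; does-⇔; dec-true; dec-false)

pattern #0 = zero
pattern #1 = suc zero
pattern #2 = suc (suc zero)
pattern #3 = suc (suc (suc zero))
pattern #4 = suc (suc (suc (suc zero)))

-- Comparing dimensions by counting Boolean functions.

funToFin-cong : ∀ {m n} {f g : Fin m → Fin n} → f ≗ g → funToFin f ≡ funToFin g
funToFin-cong {zero}  f≗g = refl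
funToFin-cong {suc m} f≗g = cong₂ combine (f≗g zero) (funToFin-cong (f≗g ∘ suc))

finToFun-injective : ∀ {m n} (k l : Fin (n ^ m)) → finToFun {n} {m} k ≗ finToFun l → k ≡ l
finToFun-injective {m} {n} k l eq = begin
  k                               ≡⟨ Finₚ.funToFin-finToFin {m} k ⟨
  funToFin (finToFun {n} {m} k)   ≡⟨ funToFin-cong eq ⟩
  funToFin (finToFun {n} {m} l)   ≡⟨ Finₚ.funToFin-finToFin {m} l ⟩
  l                               ∎
  where open ≡-Reasoning

2^-cancel-≤ : ∀ {a b} → 2 ^ a ≤ 2 ^ b → a ≤ b
2^-cancel-≤ {a} {b} le with a ℕ.≤? b
... | yes a≤b = a≤b
... | no  a≰b = contradiction le (ℕₚ.<⇒≱ (ℕₚ.^-monoʳ-< 2 (s≤s (s≤s z≤n)) (ℕₚ.≰⇒> a≰b)))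

-- Counting gives `2 ^ a ≤ 2 ^ b`, which plays the part of a comparison of dimensions over the field
-- with two elements. Functions are coded by numbers so that pointwise equality becomes equality.
cube-embedding-≤ : ∀ {A B : Set} {a b} → Fin a ↔ A → Fin b ↔ B →
  (Φ : (A → Bool) → (B → Bool)) → (∀ g h → Φ g ≗ Φ h → g ≗ h) → a ≤ b
cube-embedding-≤ {A} {B} {a} {b} A↔ B↔ Φ Φ-inj = 2^-cancel-≤ (Finₚ.injective⇒≤ {f = code} code-inj)
  where
  module IA = Inverse A↔
  module IB = Inverse B↔
  module I2 = Inverse Finₚ.2↔Bool
  word : Fin (2 ^ a) → A → Bool
  word k x = I2.to (finToFun {2} {a} k (IA.from x))
  code : Fin (2 ^ a) → Fin (2 ^ b)
  code k = funToFin (λ j → I2.from (Φ (word k) (IB.to j)))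
  Φ-decode : ∀ k y → I2.to (finToFun {2} {b} (code k) (IB.from y)) ≡ Φ (word k) y
  Φ-decode k y = begin
    I2.to (finToFun {2} {b} (code k) (IB.from y))     ≡⟨ cong I2.to (Finₚ.finToFun-funToFin _ (IB.from y)) ⟩
    I2.to (I2.from (Φ (word k) (IB.to (IB.from y))))  ≡⟨ I2.strictlyInverseˡ _ ⟩
    Φ (word k) (IB.to (IB.from y))                    ≡⟨ cong (Φ (word k)) (IB.strictlyInverseˡ y) ⟩
    Φ (word k) y                                      ∎
    where open ≡-Reasoning
  word-inj : ∀ k l → word k ≗ word l → k ≡ l
  word-inj k l eq = finToFun-injective {a} k l λ i → begin
    finToFun {2} {a} k i                  ≡⟨ cong (finToFun {2} {a} k) (IA.strictlyInverseʳ i) ⟨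
    finToFun {2} {a} k (IA.from (IA.to i)) ≡⟨ I2.strictlyInverseʳ _ ⟨
    I2.from (word k (IA.to i))            ≡⟨ cong I2.from (eq (IA.to i)) ⟩
    I2.from (word l (IA.to i))            ≡⟨ I2.strictlyInverseʳ _ ⟩
    finToFun {2} {a} l (IA.from (IA.to i)) ≡⟨ cong (finToFun {2} {a} l) (IA.strictlyInverseʳ i) ⟩
    finToFun {2} {a} l i                  ∎
    where open ≡-Reasoning
  code-inj : ∀ {k l} → code k ≡ code l → k ≡ l
  code-inj {k} {l} eq = word-inj k l (Φ-inj (word k) (word l) λ y →
    trans (sym (Φ-decode k y))
          (trans (cong (λ m → I2.to (finToFun {2} {b} m (IB.from y))) eq) (Φ-decode l y)))

_≟ᵈ_ : ∀ {V} → DecidableEquality (Dart V)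
_≟ᵈ_ = ×ₚ.≡-dec Finₚ._≟_ Finₚ._≟_

-- Finite sums modulo 2.

⨁ : ∀ {n} → (Fin n → Bool) → Bool
⨁ {zero}  f = false
⨁ {suc n} f = f zero xor ⨁ (f ∘ suc)

⨁-cong : ∀ {n} {f g : Fin n → Bool} → f ≗ g → ⨁ f ≡ ⨁ g
⨁-cong {zero}  eq = refl
⨁-cong {suc n} eq = cong₂ _xor_ (eq zero) (⨁-cong (eq ∘ suc))

⨁-false : ∀ {n} {f : Fin n → Bool} → (∀ i → f i ≡ false) → ⨁ f ≡ false
⨁-false {zero}  eq = refl
⨁-false {suc n} eq = cong₂ _xor_ (eq zero) (⨁-false (eq ∘ suc))

xor-false : ∀ a b → false ≡ a xor b → a ≡ b
xor-false false false eq = refl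
xor-false true  true  eq = refl

xor-interchange : ∀ a b c d → (a xor b) xor (c xor d) ≡ (a xor c) xor (b xor d)
xor-interchange = solve 4 (λ a b c d → (a :+ b) :+ (c :+ d) := (a :+ c) :+ (b :+ d)) refl
  where open xor-∧-Solver

⨁-xor : ∀ {n} (f g : Fin n → Bool) → ⨁ (λ i → f i xor g i) ≡ ⨁ f xor ⨁ g
⨁-xor {zero}  f g = refl
⨁-xor {suc n} f g rewrite ⨁-xor (f ∘ suc) (g ∘ suc) =
  xor-interchange (f zero) (g zero) (⨁ (f ∘ suc)) (⨁ (g ∘ suc))

⨁-single : ∀ {n} (f : Fin n → Bool) k → (∀ i → i ≢ k → f i ≡ false) → ⨁ f ≡ f k
⨁-single f zero    eq = trans (cong (f zero xor_) (⨁-false (λ i → eq (suc i) λ ())))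
                              (Boolₚ.xor-identityʳ _)
⨁-single f (suc k) eq = trans (cong (_xor ⨁ (f ∘ suc)) (eq zero λ ()))
                              (⨁-single (f ∘ suc) k λ i i≢k → eq (suc i) (i≢k ∘ Finₚ.suc-injective))

-- Chains modulo 2: boundaries, face colourings and Euler's formula.

module Homology {V : ℕ} (G : CubicMap V) (isMap : IsMap G)
  (connected : ∀ x y → Reach G [] x y) where
  open CubicMap G

  αα : ∀ d → α (α d) ≡ d
  αα = proj₁ isMap

  -- Chains modulo 2 are functions on darts; the `Symmetric` ones are the edge sets, and for these
  -- `∂` is the boundary map.
  Edges : Set
  Edges = Dart V → Bool

  Symmetric : Edges → Set
  Symmetric w = ∀ d → w (α d) ≡ w d

  ∂ : Edges → Fin V → Bool
  ∂ w v = w (v , #0) xor (w (v , #1) xor w (v , #2))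

  ∂-cong : ∀ {w w′} → w ≗ w′ → ∂ w ≗ ∂ w′
  ∂-cong eq v = cong₂ _xor_ (eq _) (cong₂ _xor_ (eq _) (eq _))

  ∂-xor : ∀ w w′ v → ∂ (λ d → w d xor w′ d) v ≡ ∂ w v xor ∂ w′ v
  ∂-xor w w′ v = solve 6 (λ a b c a′ b′ c′ →
      (a :+ a′) :+ ((b :+ b′) :+ (c :+ c′)) := (a :+ (b :+ c)) :+ (a′ :+ (b′ :+ c′))) refl
      (w (v , #0)) (w (v , #1)) (w (v , #2))
      (w′ (v , #0)) (w′ (v , #1)) (w′ (v , #2))
    where open xor-∧-Solver

  ∂-∧ : ∀ b w v → ∂ (λ d → b ∧ w d) v ≡ b ∧ ∂ w v
  ∂-∧ true  w v = refl
  ∂-∧ false w v = refl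

  ∂-⨁ : ∀ {n} (w : Fin n → Edges) v → ∂ (λ d → ⨁ (λ i → w i d)) v ≡ ⨁ (λ i → ∂ (w i) v)
  ∂-⨁ {zero}  w v = refl
  ∂-⨁ {suc n} w v = trans (∂-xor (w zero) (λ d → ⨁ (λ i → w (suc i) d)) v) (cong (∂ (w zero) v xor_) (∂-⨁ (w ∘ suc) v))

  ind : Dart V → Edges
  ind e d = does (d ≟ᵈ e)

  ∂-ind : ∀ e v → ∂ (ind e) v ≡ does (v Finₚ.≟ vert e)
  ∂-ind (x , zero) v with v Finₚ.≟ x
  ... | yes refl = refl
  ... | no _     = refl
  ∂-ind (x , #1) v with v Finₚ.≟ x
  ... | yes refl = refl
  ... | no _     = refl
  ∂-ind (x , #2) v with v Finₚ.≟ x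
  ... | yes refl = refl
  ... | no _     = refl

  edge : Dart V → Edges
  edge e d = ind e d xor ind (α e) d

  ind-α : ∀ e d → ind e (α d) ≡ ind (α e) d
  ind-α e d = does-⇔ (mk⇔ (λ p → trans (sym (αα d)) (cong α p)) (λ p → trans (cong α p) (αα e)))
                     (α d ≟ᵈ e) (d ≟ᵈ α e)

  edge-sym : ∀ e → Symmetric (edge e)
  edge-sym e d rewrite ind-α e d | ind-α (α e) d | αα e = Boolₚ.xor-comm (ind (α e) d) (ind e d)

  walk : ∀ {S x y} → Reach G S x y → Edges
  walk (here _)                d = false
  walk (step {x} _ (i , _) p)  d = edge (x , i) d xor walk p d

  walk-sym : ∀ {S x y} (p : Reach G S x y) → Symmetric (walk p)
  walk-sym (here _)         d = refl
  walk-sym (step _ (i , _) p) d = cong₂ _xor_ (edge-sym _ d) (walk-sym p d)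

  -- Telescoping: the inner vertices cancel modulo 2, and so do the two ends when they coincide.
  ∂-walk : ∀ {S x y} (p : Reach G S x y) v →
    ∂ (walk p) v ≡ does (v Finₚ.≟ x) xor does (v Finₚ.≟ y)
  ∂-walk (here {x} _) v = sym (Boolₚ.xor-same (does (v Finₚ.≟ x)))
  ∂-walk (step {x} {z = z} x∉S (i , refl) p) v = begin
    ∂ (walk (step x∉S (i , refl) p)) v               ≡⟨ ∂-xor (edge (x , i)) (walk p) v ⟩
    ∂ (edge (x , i)) v xor ∂ (walk p) v               ≡⟨ cong₂ _xor_ (∂-xor (ind (x , i)) (ind (α (x , i))) v) (∂-walk p v) ⟩
    (∂ (ind (x , i)) v xor ∂ (ind (α (x , i))) v) xor (M xor Z)
      ≡⟨ cong (_xor (M xor Z)) (cong₂ _xor_ (∂-ind (x , i) v) (∂-ind (α (x , i)) v)) ⟩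
    (X xor M) xor (M xor Z)                           ≡⟨ solve 3 (λ a b c → (a :+ b) :+ (b :+ c) := a :+ c) refl X M Z ⟩
    X xor Z                                           ∎
    where
    open ≡-Reasoning
    open xor-∧-Solver
    X = does (v Finₚ.≟ x)
    M = does (v Finₚ.≟ vert (α (x , i)))
    Z = does (v Finₚ.≟ z)

  module _ (root : Fin V) where

    -- One walk to `root` for each vertex of `s`. This realises any prescribed boundary away from
    -- the root, since there each walk contributes only its start.
    trees : (Fin V → Bool) → Edges
    trees s d = ⨁ (λ v → s v ∧ walk (connected v root) d)

    trees-sym : ∀ s → Symmetric (trees s)
    trees-sym s d = ⨁-cong (λ v → cong (s v ∧_) (walk-sym (connected v root) d))

    trees-cong : ∀ {s s′} → s ≗ s′ → trees s ≗ trees s′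
    trees-cong eq d = ⨁-cong (λ v → cong (_∧ walk (connected v root) d) (eq v))

    ∂-trees : ∀ s v → v ≢ root → ∂ (trees s) v ≡ s v
    ∂-trees s v v≢r = begin
      ∂ (trees s) v                                   ≡⟨ ∂-⨁ (λ u d → s u ∧ walk (connected u root) d) v ⟩
      ⨁ (λ u → ∂ (λ d → s u ∧ walk (connected u root) d) v)
        ≡⟨ ⨁-cong (λ u → trans (∂-∧ (s u) (walk (connected u root)) v)
                                (cong (s u ∧_) (∂-walk (connected u root) v))) ⟩
      ⨁ (λ u → s u ∧ (does (v Finₚ.≟ u) xor does (v Finₚ.≟ root)))
        ≡⟨ ⨁-single (λ u → s u ∧ (does (v Finₚ.≟ u) xor does (v Finₚ.≟ root))) v off ⟩
      s v ∧ (does (v Finₚ.≟ v) xor does (v Finₚ.≟ root))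
        ≡⟨ cong (s v ∧_) (cong₂ _xor_ (dec-true (v Finₚ.≟ v) refl) (dec-false (v Finₚ.≟ root) v≢r)) ⟩
      s v ∧ true                                      ≡⟨ Boolₚ.∧-identityʳ _ ⟩
      s v                                             ∎
      where
      open ≡-Reasoning
      off : ∀ u → u ≢ v → s u ∧ (does (v Finₚ.≟ u) xor does (v Finₚ.≟ root)) ≡ false
      off u u≢v rewrite dec-false (v Finₚ.≟ u) (u≢v ∘ sym) | dec-false (v Finₚ.≟ root) v≢r =
        Boolₚ.∧-zeroʳ (s u)

  -- The coboundary: when `c` colours faces, these are the edges whose two sides have different
  -- colours.
  δ : Edges → Edges
  δ c d = c d xor c (α d)

  FaceConstant : Edges → Set
  FaceConstant c = ∀ d → c (φ G d) ≡ c d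

  -- `φ` sends `α d` to `σ d`, so both lie on one face. Hence the colours of the faces around a
  -- vertex can be read from its own three darts.
  face-σ : ∀ {c} → FaceConstant c → ∀ d → c (α d) ≡ c (σ G d)
  face-σ {c} inv d = trans (sym (inv (α d))) (cong (c ∘ σ G) (αα d))

  -- Each corner at `v` borders two of the edges at `v`, so its colour is counted twice.
  ∂-δ : ∀ {c} → FaceConstant c → ∀ v → ∂ (δ c) v ≡ false
  ∂-δ {c} inv v
    rewrite face-σ {c} inv (v , #0) | face-σ {c} inv (v , #1) | face-σ {c} inv (v , #2) =
    solve 3 (λ a b c → (a :+ b) :+ ((b :+ c) :+ (c :+ a)) := con false) refl
      (c (v , #0)) (c (v , #1)) (c (v , #2))
    where open xor-∧-Solver

  -- Any dart reaches any other by rotating at vertices and passing along the edges of a connecting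
  -- path, and neither move changes the colour.
  constant : ∀ {c : Edges} → FaceConstant c → (∀ d → c (α d) ≡ c d) → ∀ d e → c d ≡ c e
  constant {c} inv-φ inv-α (x , i) (y , j) = trans (spin x i zero) (trans (along (connected x y)) (spin y zero j))
    where
    σ-inv : ∀ d → c (σ G d) ≡ c d
    σ-inv d = trans (sym (face-σ {c} inv-φ d)) (inv-α d)
    to-zero : ∀ v i → c (v , i) ≡ c (v , zero)
    to-zero v zero = refl
    to-zero v #1   = σ-inv (v , #0)
    to-zero v #2   = sym (σ-inv (v , #2))
    spin : ∀ v i j → c (v , i) ≡ c (v , j)
    spin v i j = trans (to-zero v i) (sym (to-zero v j))
    along : ∀ {x y} → Reach G [] x y → c (x , zero) ≡ c (y , zero)
    along (here _)                  = refl
    along (step {x} _ (i , refl) p) =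
      trans (spin x zero i) (trans (sym (inv-α (x , i))) (trans (spin _ _ zero) (along p)))

  -- The edge sets δ c + b z + trees s are pairwise distinct up to the values
  -- of c and s at the root, so if z is not of the form δ c there are at least
  -- 2 ^ (F + 1 + V ∸ 2) edge sets, whereas the number of edges is F + V ∸ 2.
  -- Two edge sets are packed into one function on darts, one on each orientation of
  -- every edge, which avoids choosing representatives of edges.
  cycles-bound : ∀ {F} → FaceCount G F → 2 * (V + F) ≡ 4 + 3 * V → Fin V →
    ∀ (z : Edges) → Symmetric z → (∀ v → ∂ z v ≡ false) →
    ¬ (∀ c → FaceConstant c → ¬ (∀ d → z d ≡ δ c d))
  cycles-bound {F} (lab , lab-φ , lab-face , lab-onto) euler root z z-sym z-even no-colouring =
    ℕₚ.<⇒≱ (count-gap F V euler) (cube-embedding-≤ A↔ B↔ Φ Φ-inj)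
    where
    root-dart : Dart V
    root-dart = root , zero
    -- Two chains of `F + 1 + V` bits each, against one bit per dart and two root values for each
    -- chain. By Euler's formula these are `3 * V + 6` bits against `3 * V + 4`.
    A = Fin 2 × (Fin F ⊎ (Fin 1 ⊎ Fin V))
    B = Dart V ⊎ (Fin 2 × Fin 2)
    A↔ : Fin (2 * (F + (1 + V))) ↔ A
    A↔ = ↔-trans Finₚ.*↔× (↔-refl ×-↔ ↔-trans Finₚ.+↔⊎ (↔-refl ⊎-↔ Finₚ.+↔⊎))
    B↔ : Fin (V * 3 + 2 * 2) ↔ B
    B↔ = ↔-trans Finₚ.+↔⊎ (Finₚ.*↔× ⊎-↔ Finₚ.*↔×)
    count-gap : ∀ F V → 2 * (V + F) ≡ 4 + 3 * V → V * 3 + 2 * 2 < 2 * (F + (1 + V))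
    count-gap F V eq = ℕₚ.≤-trans (ℕₚ.n≤1+n _) (ℕₚ.≤-reflexive
      (trans (rearr₁ V) (trans (cong (2 +_) (sym eq)) (rearr₂ F V))))
      where
      rearr₁ : ∀ V → suc (suc (V * 3 + 2 * 2)) ≡ 2 + (4 + 3 * V)
      rearr₁ = solve-∀
      rearr₂ : ∀ F V → 2 + 2 * (V + F) ≡ 2 * (F + (1 + V))
      rearr₂ = solve-∀

    Chain : Set
    Chain = (Fin F ⊎ (Fin 1 ⊎ Fin V)) → Bool
    col : Chain → Edges
    col g d = g (inj₁ (lab d))
    bit : Chain → Bool
    bit g = g (inj₂ (inj₁ zero))
    src : Chain → Fin V → Bool
    src g v = g (inj₂ (inj₂ v))
    col-φ : ∀ g → FaceConstant (col g)
    col-φ g d = cong (g ∘ inj₁) (lab-φ d)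

    Ψ : Chain → Edges
    Ψ g d = (δ (col g) d xor (bit g ∧ z d)) xor trees root (src g) d

    Ψ-sym : ∀ g → Symmetric (Ψ g)
    Ψ-sym g d = cong₂ _xor_ (cong₂ _xor_ δ-sym (cong (bit g ∧_) (z-sym d))) (trees-sym root (src g) d)
      where
      δ-sym : δ (col g) (α d) ≡ δ (col g) d
      δ-sym rewrite αα d = Boolₚ.xor-comm (col g (α d)) (col g d)

    ∂-Ψ : ∀ g v → v ≢ root → ∂ (Ψ g) v ≡ src g v
    ∂-Ψ g v v≢r = begin
      ∂ (Ψ g) v
        ≡⟨ ∂-xor (λ d → δ (col g) d xor (bit g ∧ z d)) (trees root (src g)) v ⟩
      ∂ (λ d → δ (col g) d xor (bit g ∧ z d)) v xor ∂ (trees root (src g)) v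
        ≡⟨ cong₂ _xor_ (∂-xor (δ (col g)) (λ d → bit g ∧ z d) v) (∂-trees root (src g) v v≢r) ⟩
      (∂ (δ (col g)) v xor ∂ (λ d → bit g ∧ z d) v) xor src g v
        ≡⟨ cong (_xor src g v) (cong₂ _xor_ (∂-δ {col g} (col-φ g) v)
             (trans (∂-∧ (bit g) z v) (trans (cong (bit g ∧_) (z-even v)) (Boolₚ.∧-zeroʳ _)))) ⟩
      src g v ∎
      where open ≡-Reasoning

    -- Boundaries recover `src` away from the root. Once the tree parts cancel, unequal bits would
    -- make `z` equal to `δ diff`; with equal bits `δ diff` vanishes, so `diff` is constant, and its
    -- value at the root is zero.
    Ψ-inj : ∀ g h → Ψ g ≗ Ψ h → col g root-dart ≡ col h root-dart → src g root ≡ src h root → g ≗ h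
    Ψ-inj g h Ψ-eq root-col root-src = pointwise
      where
      src-eq : src g ≗ src h
      src-eq v with v Finₚ.≟ root
      ... | yes refl = root-src
      ... | no  v≢r  = trans (sym (∂-Ψ g v v≢r)) (trans (∂-cong Ψ-eq v) (∂-Ψ h v v≢r))
      xor-cancel : ∀ a b c → a xor c ≡ b xor c → a ≡ b
      xor-cancel false false c eq = refl
      xor-cancel false true  false ()
      xor-cancel false true  true  ()
      xor-cancel true  false false ()
      xor-cancel true  false true  ()
      xor-cancel true  true  c eq = refl
      closed-eq : ∀ d → δ (col g) d xor (bit g ∧ z d) ≡ δ (col h) d xor (bit h ∧ z d)
      closed-eq d = xor-cancel _ _ (trees root (src g) d)
        (trans (Ψ-eq d) (cong ((δ (col h) d xor (bit h ∧ z d)) xor_) (sym (trees-cong root src-eq d))))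
      diff : Edges
      diff d = col g d xor col h d
      diff-φ : FaceConstant diff
      diff-φ d = cong₂ _xor_ (col-φ g d) (col-φ h d)
      -- The bits enter as variables with equations, so that in `bit-eq` the left side reduces to
      -- `z d` when they differ.
      δ-diff : ∀ b b′ → bit g ≡ b → bit h ≡ b′ → ∀ d → (b xor b′) ∧ z d ≡ δ diff d
      δ-diff b b′ refl refl d = begin
        (bit g xor bit h) ∧ z d
          ≡⟨ solve 4 (λ x b b′ z → (b :+ b′) :* z := (x :+ b :* z) :+ (x :+ b′ :* z)) refl
               (δ (col g) d) (bit g) (bit h) (z d) ⟩
        (δ (col g) d xor (bit g ∧ z d)) xor (δ (col g) d xor (bit h ∧ z d))
          ≡⟨ cong (_xor (δ (col g) d xor (bit h ∧ z d))) (closed-eq d) ⟩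
        (δ (col h) d xor (bit h ∧ z d)) xor (δ (col g) d xor (bit h ∧ z d))
          ≡⟨ solve 5 (λ a a′ b b′ y → ((b :+ b′) :+ y) :+ ((a :+ a′) :+ y) := (a :+ b) :+ (a′ :+ b′)) refl
               (col g d) (col g (α d)) (col h d) (col h (α d)) (bit h ∧ z d) ⟩
        δ diff d ∎
        where
        open ≡-Reasoning
        open xor-∧-Solver
      bit-eq : ∀ b b′ → bit g ≡ b → bit h ≡ b′ → b ≡ b′
      bit-eq true  true  p q = refl
      bit-eq false false p q = refl
      bit-eq true  false p q = contradiction (δ-diff true false p q) (no-colouring diff diff-φ)
      bit-eq false true  p q = contradiction (δ-diff false true p q) (no-colouring diff diff-φ)
      bits : bit g ≡ bit h
      bits = bit-eq _ _ refl refl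
      diff-α : ∀ d → diff (α d) ≡ diff d
      diff-α d = sym (xor-false _ _ (trans (sym (cong (_∧ z d)
                                       (trans (cong (_xor bit h) bits) (Boolₚ.xor-same (bit h)))))
                                     (δ-diff _ _ refl refl d)))
      col-eq : ∀ d → col g d ≡ col h d
      col-eq d = sym (xor-false _ _ (trans (sym (trans (cong (_xor col h root-dart) root-col) (Boolₚ.xor-same (col h root-dart))))
                   (trans (constant {diff} diff-φ diff-α root-dart d) (Boolₚ.xor-comm (col g d) (col h d)))))
      pointwise : g ≗ h
      pointwise (inj₁ f) with lab-onto f
      ... | d , refl = col-eq d
      pointwise (inj₂ (inj₁ zero)) = bits
      pointwise (inj₂ (inj₂ v))    = src-eq v

    rank : Dart V → Fin (V * 3)
    rank (v , i) = combine v i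
    rank-inj : ∀ d e → rank d ≡ rank e → d ≡ e
    rank-inj (v , i) (u , j) eq with Finₚ.combine-injective v i u j eq
    ... | refl , refl = refl
    forward? : ∀ d → Dec (rank d Fin.< rank (α d))
    forward? d = rank d Finₚ.<? rank (α d)
    pick : ∀ {P : Set} → Dec P → Fin 2
    pick (yes _) = zero
    pick (no _)  = #1
    -- The dart of smaller rank on each edge carries the first chain, its reverse the second.
    layer : Dart V → Fin 2
    layer d = pick (forward? d)
    find-layer : ∀ d i → layer d ≡ i ⊎ layer (α d) ≡ i
    find-layer d i with forward? d | forward? (α d)
    find-layer d zero       | yes _ | _     = inj₁ refl
    find-layer d zero       | no _  | yes _ = inj₂ refl
    find-layer d zero       | no ¬p | no ¬q =
      contradiction (rank-inj _ _ (Finₚ.≤-antisym (ℕₚ.≮⇒≥ ¬p)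
                      (ℕₚ.≮⇒≥ (¬q ∘ subst (rank (α d) Fin.<_) (cong rank (sym (αα d)))))))
                    (proj₂ isMap d)
    find-layer d #1 | no _  | _     = inj₁ refl
    find-layer d #1 | yes _ | no _  = inj₂ refl
    find-layer d #1 | yes p | yes q =
      contradiction (subst (rank (α d) Fin.<_) (cong rank (αα d)) q) (ℕₚ.<-asym p)

    Φ : (A → Bool) → (B → Bool)
    Φ g (inj₁ d)               = Ψ (λ x → g (layer d , x)) d
    Φ g (inj₂ (zero , i))      = g (i , inj₁ (lab root-dart))
    Φ g (inj₂ (#1 , i))  = g (i , inj₂ (inj₂ root))

    Φ-inj : ∀ g h → Φ g ≗ Φ h → g ≗ h
    Φ-inj g h eq (i , x) = Ψ-inj (λ x → g (i , x)) (λ x → h (i , x)) layers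
                             (eq (inj₂ (#0 , i))) (eq (inj₂ (#1 , i))) x
      where
      -- A symmetric function is known from one orientation of each edge, so the darts in layer `i`
      -- suffice.
      layers : Ψ (λ x → g (i , x)) ≗ Ψ (λ x → h (i , x))
      layers d with find-layer d i
      ... | inj₁ refl = eq (inj₁ d)
      ... | inj₂ refl = 
        trans (sym (Ψ-sym (λ x → g (layer (α d) , x)) d))
              (trans (eq (inj₁ (α d))) (Ψ-sym (λ x → h (layer (α d) , x)) d))

-- Triples of darts, majorities and splittings into two classes.

rot-≢ : ∀ i → rot i ≢ i
rot-≢ zero ()
rot-≢ #1 ()
rot-≢ #2 ()

rot²-≢ : ∀ i → rot (rot i) ≢ i
rot²-≢ zero ()
rot²-≢ #1 ()
rot²-≢ #2 ()

other-index : (i j : Fin 3) → ∃ λ k → k ≢ i × k ≢ j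
other-index #0 #0 = #1 , (λ ()) , λ ()
other-index #0 #1 = #2 , (λ ()) , λ ()
other-index #0 #2 = #1 , (λ ()) , λ ()
other-index #1 #0 = #2 , (λ ()) , λ ()
other-index #1 #1 = #0 , (λ ()) , λ ()
other-index #1 #2 = #0 , (λ ()) , λ ()
other-index #2 #0 = #1 , (λ ()) , λ ()
other-index #2 #1 = #0 , (λ ()) , λ ()
other-index #2 #2 = #0 , (λ ()) , λ ()

xor-two : ∀ (f : Fin 3 → Bool) {i j} → i ≢ j → f i ≡ true → f j ≡ true →
  (∀ k → k ≢ i → k ≢ j → f k ≡ false) → f #0 xor (f #1 xor f #2) ≡ false
xor-two f {zero} {zero} i≢j p q r = contradiction refl i≢j
xor-two f {#1} {#1} i≢j p q r = contradiction refl i≢j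
xor-two f {#2} {#2} i≢j p q r = contradiction refl i≢j
xor-two f {#0} {#1} i≢j p q r rewrite p | q | r #2 (λ ()) (λ ()) = refl
xor-two f {#0} {#2} i≢j p q r rewrite p | q | r #1 (λ ()) (λ ()) = refl
xor-two f {#1} {#0} i≢j p q r rewrite p | q | r #2 (λ ()) (λ ()) = refl
xor-two f {#1} {#2} i≢j p q r rewrite p | q | r #0 (λ ()) (λ ()) = refl
xor-two f {#2} {#0} i≢j p q r rewrite p | q | r #1 (λ ()) (λ ()) = refl
xor-two f {#2} {#1} i≢j p q r rewrite p | q | r #0 (λ ()) (λ ()) = refl

xor-true : ∀ a b c → true ≡ a xor b → a ≡ c ⊎ b ≡ c
xor-true false true false eq = inj₁ refl
xor-true false true true eq = inj₂ refl
xor-true true false false eq = inj₂ refl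
xor-true true false true eq = inj₁ refl

majority : (Fin 3 → Bool) → Bool
majority f = f #0 ∧ f #1 ∨ f #1 ∧ f #2 ∨ f #2 ∧ f #0

majority-rot : ∀ f i → f i ≡ f (rot i) → majority f ≡ f i
majority-rot f #0 eq with f #0 | f #1 | f #2 | eq
... | true  | .true  | c     | refl = refl
... | false | .false | true  | refl = refl
... | false | .false | false | refl = refl
majority-rot f #1 eq with f #0 | f #1 | f #2 | eq
... | true  | true  | .true  | refl = refl
... | false | true  | .true  | refl = refl
... | true  | false | .false | refl = refl
... | false | false | .false | refl = refl
majority-rot f #2 eq with f #0 | f #1 | f #2 | eq
... | .true  | true  | true  | refl = refl
... | .true  | false | true  | refl = refl
... | .false | true  | false | refl = refl
... | .false | false | false | refl = refl

module _ {A : Set} (K : A → Bool) where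

  level : Bool → List A → List A
  level b = filter (λ x → K x Boolₚ.≟ b)

  length-levels : ∀ xs → length (level true xs) + length (level false xs) ≡ length xs
  length-levels [] = refl
  length-levels (x ∷ xs) with K x
  ... | true  = cong suc (length-levels xs)
  ... | false = trans (ℕₚ.+-suc _ _) (cong suc (length-levels xs))

  level-witness : ∀ b xs → 0 < length (level b xs) → ∃ λ x → x ∈ xs × K x ≡ b
  level-witness b xs pos with level b xs in eq
  ... | y ∷ ys = y , ∈-filter⁻ (λ x → K x Boolₚ.≟ b) {xs = xs} (subst (y ∈_) (sym eq) (here refl))

  -- Two classes of three or more entries would need six, and a class of at most two cannot exhaust
  -- three entries. For the vertices of a short cycle, the small class is a separator to which
  -- 3-connectedness applies.
  small-level : ∀ xs → 3 ≤ length xs → length xs ≤ 5 →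
    ∃ λ b → length (level b xs) ≤ 2 × ∃ λ x → x ∈ xs × K x ≡ not b
  small-level xs 3≤ ≤5 with length (level true xs) ℕ.≤? 2
  ... | yes t≤2 = true , t≤2 , level-witness false xs
    (ℕₚ.+-cancelˡ-≤ 2 _ _ (ℕₚ.≤-trans 3≤ (ℕₚ.≤-trans (ℕₚ.≤-reflexive (sym (length-levels xs)))
                                                    (ℕₚ.+-monoˡ-≤ (length (level false xs)) t≤2))))
  ... | no  t≰2 = false
    , ℕₚ.+-cancelˡ-≤ 3 _ _ (ℕₚ.≤-trans (ℕₚ.+-monoˡ-≤ (length (level false xs)) (ℕₚ.≰⇒> t≰2))
                                       (ℕₚ.≤-trans (ℕₚ.≤-reflexive (length-levels xs)) ≤5))
    , level-witness true xs (ℕₚ.≤-trans (s≤s z≤n) (ℕₚ.≰⇒> t≰2))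

-- Short chordless cycles bound faces.

record CyclicOrder (ℓ : ℕ) : Set where
  field
    next prev : Fin ℓ → Fin ℓ
    next-prev : ∀ i → next (prev i) ≡ i
    prev-next : ∀ i → prev (next i) ≡ i
    next≢prev : ∀ i → next i ≢ prev i

module Planar {V : ℕ} (G : CubicMap V) (isMap : IsMap G) (simple : Simple G)
  (3-conn : ThreeConnected G) (plane : Plane G) where
  open CubicMap G

  connected : ∀ x y → Reach G [] x y
  connected x y = proj₂ 3-conn [] z≤n x y (λ ()) (λ ())

  open Homology G isMap connected

  dart-unique : ∀ {d e} → vert d ≡ vert e → vert (α d) ≡ vert (α e) → d ≡ e
  dart-unique {v , i} {.v , j} refl eq with i Finₚ.≟ j
  ... | yes refl = refl
  ... | no  i≢j  = contradiction eq (proj₂ simple v i j i≢j)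

  start∉ : ∀ {S x y} → Reach G S x y → x ∉ S
  start∉ (here x∉S)     = x∉S
  start∉ (step x∉S _ _) = x∉S

  module Cycle {ℓ : ℕ} (order : CyclicOrder ℓ) (3≤ℓ : 3 ≤ ℓ) (ℓ≤5 : ℓ ≤ 5)
    (e : Fin ℓ → Dart V)
    (link : ∀ i → vert (α (e i)) ≡ vert (e (CyclicOrder.next order i)))
    (e-inj : ∀ i j → vert (e i) ≡ vert (e j) → i ≡ j)
    (chordless : ∀ d i j → vert d ≡ vert (e i) → vert (α d) ≡ vert (e j) →
      j ≡ CyclicOrder.next order i ⊎ j ≡ CyclicOrder.prev order i)
    where
    open CyclicOrder order

    OnCycle : Dart V → Set
    OnCycle d = ∃ λ i → d ≡ e i ⊎ d ≡ α (e i)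

    onCycle? : ∀ d → Dec (OnCycle d)
    onCycle? d = Finₚ.any? λ i → (d ≟ᵈ e i) ⊎-dec (d ≟ᵈ α (e i))

    onCycle-α : ∀ {d} → OnCycle d → OnCycle (α d)
    onCycle-α (i , inj₁ refl) = i , inj₂ refl
    onCycle-α (i , inj₂ refl) = i , inj₁ (αα (e i))

    onCycle-vert : ∀ {d} → OnCycle d → ∃ λ i → vert d ≡ vert (e i)
    onCycle-vert (i , inj₁ refl) = i , refl
    onCycle-vert (i , inj₂ refl) = next i , link i

    link-prev : ∀ i → vert (α (e (prev i))) ≡ vert (e i)
    link-prev i = trans (link (prev i)) (cong (vert ∘ e) (next-prev i))

    darts-at : ∀ {d} i → OnCycle d → vert d ≡ vert (e i) → d ≡ e i ⊎ d ≡ α (e (prev i))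
    darts-at i (j , inj₁ refl) eq = inj₁ (cong e (e-inj j i eq))
    darts-at i (j , inj₂ refl) eq with e-inj (next j) i (trans (sym (link j)) eq)
    ... | refl = inj₂ (cong (α ∘ e) (sym (prev-next j)))

    out≢in : ∀ i → e i ≢ α (e (prev i))
    out≢in i eq = next≢prev i (e-inj _ _ (trans (sym (link i)) (trans (cong (vert ∘ α) eq) (cong vert (αα _)))))

    z : Edges
    z d = does (onCycle? d)

    z-sym : Symmetric z
    z-sym d = does-⇔ (mk⇔ (subst OnCycle (αα d) ∘ onCycle-α) onCycle-α) (onCycle? (α d)) (onCycle? d)

    -- A cycle vertex carries two cycle darts, the outgoing one and the reverse of the incoming one;
    -- any other vertex carries none.
    z-even : ∀ v → ∂ z v ≡ false
    z-even v with Finₚ.any? (λ i → v Finₚ.≟ vert (e i))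
    ... | yes (i , refl) = xor-two (λ k → z (v , k)) {proj₂ (e i)} {proj₂ (α (e (prev i)))}
        (λ eq → out≢in i (trans (cong (v ,_) eq) in-eq))
        (dec-true (onCycle? (e i)) (i , inj₁ refl))
        (dec-true (onCycle? (v , _)) (prev i , inj₂ in-eq))
        (λ k k≢out k≢in → dec-false (onCycle? (v , k)) λ on →
          [ k≢out ∘ cong proj₂ , k≢in ∘ cong proj₂ ]′ (darts-at i on refl))
      where
      in-eq : (v , proj₂ (α (e (prev i)))) ≡ α (e (prev i))
      in-eq = cong (_, proj₂ (α (e (prev i)))) (sym (link-prev i))
    ... | no off = cong₂ _xor_ (z-off #0) (cong₂ _xor_ (z-off #1) (z-off #2))
      where
      z-off : ∀ k → z (v , k) ≡ false
      z-off k = dec-false (onCycle? (v , k)) (off ∘ onCycle-vert)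

    stub : ∀ i → ∃ λ d → vert d ≡ vert (e i) × ¬ OnCycle d
    stub i with other-index (proj₂ (e i)) (proj₂ (α (e (prev i))))
    ... | k , k≢out , k≢in = (vert (e i) , k) , refl , λ on →
      [ k≢out ∘ cong proj₂ , k≢in ∘ cong proj₂ ]′ (darts-at i on refl)

    -- The two alternatives are the two sides of the cycle: face tracing runs along it from `e i`,
    -- or against it from the reverse dart.
    Facial : Fin ℓ → Set
    Facial i = (∀ k → iter (φ G) k (e i) ≡ e (iter next k i))
             ⊎ (∀ k → iter (φ G) k (α (e i)) ≡ α (e (iter prev k i)))

    module Coloured (c : Edges) (c-φ : FaceConstant c) (z≡δc : ∀ d → z d ≡ δ c d) where

      -- Off the cycle all three corners at a vertex have the same colour; at a cycle
      -- vertex the majority colour is that of the two corners along its third edge.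
      side : Fin V → Bool
      side v = majority (λ i → c (v , i))

      off-α : ∀ {d} → ¬ OnCycle d → c d ≡ c (α d)
      off-α {d} off = xor-false _ _ (trans (sym (dec-false (onCycle? d) off)) (z≡δc d))

      -- Both sides of an edge off the cycle have the same colour, so two of the three corners at
      -- the vertex agree and decide the majority.
      side-off : ∀ {d} → ¬ OnCycle d → side (vert d) ≡ c d
      side-off {v , i} off = majority-rot (λ i → c (v , i)) i (trans (off-α off) (face-σ {c} c-φ (v , i)))

      side-edge : ∀ {d} → ¬ OnCycle d → side (vert (α d)) ≡ side (vert d)
      side-edge {d} off = trans (side-off (off ∘ subst OnCycle (αα d) ∘ onCycle-α))
                                (trans (sym (off-α off)) (sym (side-off off)))

      vertices : List (Fin V)
      vertices = List.tabulate (vert ∘ e)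

      module Small (b : Bool) (small : length (level side b vertices) ≤ 2)
        (opposite : ∃ λ i → side (vert (e i)) ≡ not b) where

        T : List (Fin V)
        T = level side b vertices

        -- Otherwise a path avoiding `T` would join `x` to a cycle vertex of the opposite side. But
        -- a vertex off the cycle passes its side on to each neighbour, and a cycle vertex of side
        -- `b` belongs to `T`, so the path never meets the cycle.
        on-cycle : ∀ x → side x ≡ b → ∃ λ i → x ≡ vert (e i)
        on-cycle x x-b with Finₚ.any? (λ i → x Finₚ.≟ vert (e i))
        ... | yes on = on
        ... | no off = contradiction refl (stay x-b off path (proj₁ opposite))
          where
          path : Reach G T x (vert (e (proj₁ opposite)))
          path = proj₂ 3-conn T small x _
            (λ x∈T → off (∈-tabulate⁻ (proj₁ (∈-filter⁻ (λ x → side x Boolₚ.≟ b) {xs = vertices} x∈T))))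
            (λ y∈T → Boolₚ.not-¬ {x = b} refl (trans (sym (proj₂ (∈-filter⁻ (λ x → side x Boolₚ.≟ b) {xs = vertices} y∈T)))
                                        (proj₂ opposite)))
          stay : ∀ {x y} → side x ≡ b → ¬ (∃ λ i → x ≡ vert (e i)) → Reach G T x y → ∀ i → y ≢ vert (e i)
          stay x-b off (here _) i eq = off (i , eq)
          stay {x} x-b off (step _ (k , refl) p) =
            stay y-b (λ { (i , eq) → start∉ p (∈-filter⁺ (λ x → side x Boolₚ.≟ b)
                                                (subst (_∈ vertices) (sym eq) (∈-tabulate⁺ i)) y-b) }) p
            where
            y-b : side (vert (α (x , k))) ≡ b
            y-b = trans (side-edge {x , k} (off ∘ onCycle-vert)) x-b

        -- The third edge at such a vertex would lead to another vertex of side `b`, hence back to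
        -- the cycle by `on-cycle`. Having no chords makes its two ends consecutive, and simplicity
        -- makes it a cycle edge.
        cycle-side : ∀ i → side (vert (e i)) ≢ b
        cycle-side i i-b with stub i
        ... | d , d-i , off with on-cycle (vert (α d)) (trans (side-edge off) (trans (cong side d-i) i-b))
        ...   | j , d-j with chordless d i j d-i d-j
        ...     | inj₁ refl = off (i , inj₁ (dart-unique d-i (trans d-j (sym (link i)))))
        ...     | inj₂ refl = off (prev i , inj₂ (dart-unique (trans d-i (sym (link-prev i)))
                                                    (trans d-j (cong vert (sym (αα (e (prev i))))))))

        -- If the face left the cycle here, its colour `b` would be the side of a cycle vertex,
        -- against `cycle-side`.
        follow : ∀ d → OnCycle d → c d ≡ b → OnCycle (φ G d)
        follow d on d-b with onCycle? (φ G d)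
        ... | yes on′ = on′
        ... | no  off with onCycle-vert (onCycle-α on)
        ...   | i , eq = contradiction (trans (cong side (sym eq)) (trans (side-off off) (trans (c-φ d) d-b)))
                                       (cycle-side i)

        forward : ∀ i → c (e i) ≡ b → φ G (e i) ≡ e (next i)
        forward i i-b with darts-at (next i) (follow (e i) (i , inj₁ refl) i-b) (link i)
        ... | inj₁ eq = eq
        -- The face cannot turn back along the same edge, since `σ` fixes no dart.
        ... | inj₂ eq rewrite prev-next i = contradiction (cong proj₂ eq) (rot-≢ _)

        backward : ∀ i → c (α (e i)) ≡ b → φ G (α (e i)) ≡ α (e (prev i))
        backward i i-b with darts-at i (follow (α (e i)) (i , inj₂ refl) i-b) (cong vert (αα (e i)))
        ... | inj₂ eq = eq
        ... | inj₁ eq rewrite αα (e i) = contradiction (cong proj₂ eq) (rot-≢ _)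

        iter-φ : ∀ k {d} → c d ≡ b → c (iter (φ G) k d) ≡ b
        iter-φ zero    d-b = d-b
        iter-φ (suc k) d-b = trans (c-φ _) (iter-φ k d-b)

        facial : ∀ i → Facial i
        -- The sides of a cycle edge differ in colour, so one of them has colour `b`; the face on
        -- that side is traced.
        facial i with xor-true (c (e i)) (c (α (e i))) b
                        (trans (sym (dec-true (onCycle? (e i)) (i , inj₁ refl))) (z≡δc (e i)))
        ... | inj₁ i-b = inj₁ run
          where
          run : ∀ k → iter (φ G) k (e i) ≡ e (iter next k i)
          run zero    = refl
          run (suc k) = trans (cong (φ G) (run k)) (forward _ (trans (cong c (sym (run k))) (iter-φ k i-b)))
        ... | inj₂ i-b = inj₂ run
          where
          run : ∀ k → iter (φ G) k (α (e i)) ≡ α (e (iter prev k i))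
          run zero    = refl
          run (suc k) = trans (cong (φ G) (run k)) (backward _ (trans (cong c (sym (run k))) (iter-φ k i-b)))

    -- `cycles-bound` only refutes that `z` has no colouring, hence the double negation. It suffices
    -- for the exclusions below, which all end in a contradiction.
    chordless⇒facial : ∀ i → ¬ ¬ Facial i
    chordless⇒facial i not-facial =
      cycles-bound (proj₁ (proj₂ plane)) (proj₂ (proj₂ plane)) (vert (e i)) z z-sym z-even
      λ c c-φ z≡δc → let open Coloured c c-φ z≡δc in
        case-small c c-φ z≡δc (small-level side vertices
          (subst (3 ≤_) (sym (Listₚ.length-tabulate (vert ∘ e))) 3≤ℓ)
          (subst (_≤ 5) (sym (Listₚ.length-tabulate (vert ∘ e))) ℓ≤5))
      where
      case-small : ∀ c c-φ z≡δc (let open Coloured c c-φ z≡δc) →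
        (∃ λ b → length (level side b vertices) ≤ 2 × ∃ λ x → x ∈ vertices × side x ≡ not b) → ⊥
      case-small c c-φ z≡δc (b , small , x , x∈ , x-b) with ∈-tabulate⁻ x∈
      ... | j , refl = not-facial (Coloured.Small.facial c c-φ z≡δc b small (j , x-b) i)

-- Excluding closed walks of length at most five.

rotation : ∀ {ℓ} (next prev : Vec (Fin ℓ) ℓ)
  {_ : True (Finₚ.all? λ i → lookup next (lookup prev i) Finₚ.≟ i)}
  {_ : True (Finₚ.all? λ i → lookup prev (lookup next i) Finₚ.≟ i)}
  {_ : True (Finₚ.all? λ i → ¬? (lookup next i Finₚ.≟ lookup prev i))} → CyclicOrder ℓ
rotation next prev {np} {pn} {n≢p} = record
  { next = lookup next ; prev = lookup prev
  ; next-prev = toWitness np ; prev-next = toWitness pn ; next≢prev = toWitness n≢p }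

order₃ : CyclicOrder 3
order₃ = rotation (#1 ∷ #2 ∷ #0 ∷ []) (#2 ∷ #0 ∷ #1 ∷ [])

order₄ : CyclicOrder 4
order₄ = rotation (#1 ∷ #2 ∷ #3 ∷ #0 ∷ []) (#3 ∷ #0 ∷ #1 ∷ #2 ∷ [])

order₅ : CyclicOrder 5
order₅ = rotation (#1 ∷ #2 ∷ #3 ∷ #4 ∷ #0 ∷ []) (#4 ∷ #0 ∷ #1 ∷ #2 ∷ #3 ∷ [])

two-others : (a : Fin 3) → ∃₂ λ b c → b ≢ a × c ≢ a × b ≢ c
two-others #0 = #1 , #2 , (λ ()) , (λ ()) , λ ()
two-others #1 = #0 , #2 , (λ ()) , (λ ()) , λ ()
two-others #2 = #0 , #1 , (λ ()) , (λ ()) , λ ()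

iter-+ : ∀ {A : Set} (f : A → A) m n x → iter f (m + n) x ≡ iter f m (iter f n x)
iter-+ f zero    n x = refl
iter-+ f (suc m) n x = cong f (iter-+ f m n x)

iter-comm : ∀ {A : Set} (f : A → A) m n x → iter f m (iter f n x) ≡ iter f n (iter f m x)
iter-comm f m n x = trans (sym (iter-+ f m n x))
  (trans (cong (λ k → iter f k x) (ℕₚ.+-comm m n)) (iter-+ f n m x))

module Girth {V : ℕ} (G : CubicMap V) (isMap : IsMap G) (simple : Simple G)
  (3-conn : ThreeConnected G) (plane : Plane G)
  (faces : ∀ d → FaceLen G d 5 ⊎ FaceLen G d 6) where
  open CubicMap G
  open Homology G isMap (Planar.connected G isMap simple 3-conn plane) using (αα)
  open Planar G isMap simple 3-conn plane

  infix 4 _~_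
  _~_ : Fin V → Fin V → Set
  _~_ = Adj G

  _~?_ : ∀ x y → Dec (x ~ y)
  x ~? y = Finₚ.any? λ i → vert (α (x , i)) Finₚ.≟ y

  dart-adj : ∀ d {x y} → vert d ≡ x → vert (α d) ≡ y → x ~ y
  dart-adj (x , i) refl eq = i , eq

  ~-sym : ∀ {x y} → x ~ y → y ~ x
  ~-sym {x} (i , eq) = dart-adj (α (x , i)) eq (cong vert (αα (x , i)))

  loopless : ∀ {x y} → x ~ y → x ≢ y
  loopless (i , eq) refl = proj₁ simple (_ , i) eq

  no-short-face : ∀ d k → 0 < k → k < 5 → iter (φ G) k d ≢ d
  no-short-face d k 0<k k<5 with faces d
  ... | inj₁ (_ , _ , least) = least k 0<k k<5
  ... | inj₂ (_ , _ , least) = least k 0<k (ℕₚ.≤-trans k<5 (ℕₚ.n≤1+n 5))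

  distinct-vertices : ∀ {n} (es : Vec (Dart V) n) → Unique (Vec.map vert es) →
    ∀ i j → vert (lookup es i) ≡ vert (lookup es j) → i ≡ j
  distinct-vertices es unique i j eq = lookup-injective unique i j
    (trans (Vecₚ.lookup-map i vert es) (trans eq (sym (Vecₚ.lookup-map j vert es))))

  -- Any two positions in a triangle are equal or consecutive, so it is chordless and would bound a
  -- face of length three.
  triangle-free : ∀ {a b c} → a ~ b → b ~ c → c ~ a → ⊥
  triangle-free {a} ab@(i , refl) bc@(j , refl) ca@(k , eq) = chordless⇒facial zero
      λ { (inj₁ f) → no-short-face _ 3 (s≤s z≤n) (s≤s (s≤s (s≤s (s≤s z≤n)))) (f 3)
        ; (inj₂ f) → no-short-face _ 3 (s≤s z≤n) (s≤s (s≤s (s≤s (s≤s z≤n)))) (f 3) }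
    where
    es = (a , i) ∷ (_ , j) ∷ (_ , k) ∷ []
    open CyclicOrder order₃
    link : ∀ i → vert (α (lookup es i)) ≡ vert (lookup es (next i))
    link = λ { #0 → refl ; #1 → refl ; #2 → eq }
    near : ∀ i j → j ≡ i ⊎ j ≡ next i ⊎ j ≡ prev i
    near = from-yes (Finₚ.all? λ i → Finₚ.all? λ j →
      (j Finₚ.≟ i) ⊎-dec (j Finₚ.≟ next i) ⊎-dec (j Finₚ.≟ prev i))
    chordless : ∀ d i j → vert d ≡ vert (lookup es i) → vert (α d) ≡ vert (lookup es j) →
      j ≡ next i ⊎ j ≡ prev i
    chordless d i j p q with near i j
    ... | inj₁ refl = contradiction (trans q (sym p)) (proj₁ simple d)
    ... | inj₂ r    = r
    open Cycle order₃ (s≤s (s≤s (s≤s z≤n))) (s≤s (s≤s (s≤s z≤n))) (lookup es)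
      link
      (distinct-vertices es ((loopless ab ∷ loopless ca ∘ sym ∷ []) ∷ (loopless bc ∷ []) ∷ [] ∷ []))
      chordless

  -- A chord between positions two apart would close a triangle, and `near` leaves no other place
  -- for a chord. For lengths four and five, `near` is checked by evaluation.
  no-chord : ∀ {ℓ} (order : CyclicOrder ℓ) (let open CyclicOrder order) (e : Fin ℓ → Dart V) →
    (∀ i → vert (α (e i)) ≡ vert (e (next i))) →
    (∀ i j → j ≡ i ⊎ j ≡ next (next i) ⊎ i ≡ next (next j) ⊎ (j ≡ next i ⊎ j ≡ prev i)) →
    ∀ d i j → vert d ≡ vert (e i) → vert (α d) ≡ vert (e j) → j ≡ next i ⊎ j ≡ prev i
  no-chord order e link near d i j p q with near i j
  ... | inj₁ refl = contradiction (trans q (sym p)) (proj₁ simple d)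
  ... | inj₂ (inj₁ refl) = ⊥-elim (triangle-free
          (dart-adj (e i) refl (link i)) (dart-adj (e _) refl (link _)) (~-sym (dart-adj d p q)))
  ... | inj₂ (inj₂ (inj₁ refl)) = ⊥-elim (triangle-free
          (dart-adj (e j) refl (link j)) (dart-adj (e _) refl (link _)) (dart-adj d p q))
  ... | inj₂ (inj₂ (inj₂ r)) = r

  -- The two inequalities make the walk a genuine cycle, chordless by `no-chord`, whereas faces have
  -- length five or six.
  quadrangle-free : ∀ {a b c d} → a ~ b → b ~ c → c ~ d → d ~ a → a ≢ c → b ≢ d → ⊥
  quadrangle-free {a} ab@(i , refl) bc@(j , refl) cd@(k , refl) da@(l , eq) a≢c b≢d = chordless⇒facial zero
      λ { (inj₁ f) → no-short-face _ 4 (s≤s z≤n) (s≤s (s≤s (s≤s (s≤s (s≤s z≤n))))) (f 4)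
        ; (inj₂ f) → no-short-face _ 4 (s≤s z≤n) (s≤s (s≤s (s≤s (s≤s (s≤s z≤n))))) (f 4) }
    where
    es = (a , i) ∷ (_ , j) ∷ (_ , k) ∷ (_ , l) ∷ []
    open CyclicOrder order₄
    link : ∀ i → vert (α (lookup es i)) ≡ vert (lookup es (next i))
    link = λ { #0 → refl ; #1 → refl ; #2 → refl ; #3 → eq }
    open Cycle order₄ (s≤s (s≤s (s≤s z≤n))) (s≤s (s≤s (s≤s (s≤s z≤n)))) (lookup es) link
      (distinct-vertices es ((loopless ab ∷ a≢c ∷ loopless da ∘ sym ∷ []) ∷ (loopless bc ∷ b≢d ∷ [])
                             ∷ (loopless cd ∷ []) ∷ [] ∷ []))
      (no-chord order₄ (lookup es) link
        (from-yes (Finₚ.all? λ i → Finₚ.all? λ j → (j Finₚ.≟ i) ⊎-dec (j Finₚ.≟ next (next i)) ⊎-dec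
          (i Finₚ.≟ next (next j)) ⊎-dec (j Finₚ.≟ next i) ⊎-dec (j Finₚ.≟ prev i))))

  closed-4-walk : ∀ {a b c d} → a ~ b → b ~ c → c ~ d → d ~ a → a ≡ c ⊎ b ≡ d
  closed-4-walk {a} {b} {c} {d} ab bc cd da with a Finₚ.≟ c | b Finₚ.≟ d
  ... | yes a≡c | _       = inj₁ a≡c
  ... | no _    | yes b≡d = inj₂ b≡d
  ... | no a≢c  | no b≢d  = ⊥-elim (quadrangle-free ab bc cd da a≢c b≢d)

  -- A closed 5-walk is a 5-cycle because there are no triangles, hence a pentagonal
  -- face; but two consecutive edges determine a face.
  no-pentagon-at : ∀ d → iter (φ G) 5 d ≢ d → ∀ {x y} →
    vert (φ G (φ G d)) ~ x → x ~ y → y ~ vert d → ⊥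
  no-pentagon-at d not-5 {x} {y} tx@(i , refl) xy@(j , refl) yu@(k , eq) = chordless⇒facial zero
      λ { (inj₁ f) → not-5 (f 5)
        -- A face on the other side would pass from the reverse of `φ d` to the reverse of `d`, so
        -- two rotations would fix `α d`.
        ; (inj₂ f) → rot²-≢ _ (cong proj₂ (trans (cong (σ G) (sym (αα (φ G d))))
                                 (trans (cong (φ G) (sym (f 4))) (f 5)))) }
    where
    u = vert d
    m = vert (φ G d)
    t = vert (φ G (φ G d))
    um : u ~ m
    um = dart-adj d refl refl
    mt : m ~ t
    mt = dart-adj (φ G d) refl refl
    -- If they coincided, `φ d` would be the reverse of `d`, whereas it is the rotation of that
    -- reverse.
    u≢t : u ≢ t
    u≢t u≡t = rot-≢ _ (cong proj₂ (dart-unique {φ G d} {α d} refl (trans (sym u≡t) (cong vert (sym (αα d))))))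
    es = d ∷ φ G d ∷ (t , i) ∷ (_ , j) ∷ (_ , k) ∷ []
    open CyclicOrder order₅
    link : ∀ i → vert (α (lookup es i)) ≡ vert (lookup es (next i))
    link = λ { #0 → refl ; #1 → refl ; #2 → refl ; #3 → refl ; #4 → eq }
    u≢x : u ≢ x
    u≢x u≡x = triangle-free um mt (subst (t ~_) (sym u≡x) tx)
    m≢x : m ≢ x
    m≢x m≡x = triangle-free um (subst (_~ y) (sym m≡x) xy) yu
    m≢y : m ≢ y
    m≢y m≡y = triangle-free mt tx (subst (x ~_) (sym m≡y) xy)
    t≢y : t ≢ y
    t≢y t≡y = triangle-free um mt (subst (_~ u) (sym t≡y) yu)
    open Cycle order₅ (s≤s (s≤s (s≤s z≤n))) ℕₚ.≤-refl (lookup es) link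
      (distinct-vertices es
        ( (loopless um ∷ u≢t ∷ u≢x ∷ loopless yu ∘ sym ∷ [])
        ∷ (loopless mt ∷ m≢x ∷ m≢y ∷ [])
        ∷ (loopless tx ∷ t≢y ∷ [])
        ∷ (loopless xy ∷ []) ∷ [] ∷ []))
      (no-chord order₅ (lookup es) link
        (from-yes (Finₚ.all? λ i → Finₚ.all? λ j → (j Finₚ.≟ i) ⊎-dec (j Finₚ.≟ next (next i)) ⊎-dec
          (i Finₚ.≟ next (next j)) ⊎-dec (j Finₚ.≟ next i) ⊎-dec (j Finₚ.≟ prev i))))

  -- Alternate corners of two hexagons.

  -- A 6-cycle is K₃,₃ minus a perfect matching: v p a and v (not p) a are antipodal.
  record HexCycle (v : Bool → Fin 3 → Fin V) : Set where
    field
      side   : ∀ {p a b} → a ≢ b → v p a ~ v (not p) b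
      corner : ∀ {p a b x y} → a ≢ b → v p a ~ x → x ~ y → y ~ v p b → ⊥

  open HexCycle

  -- Neighbours that are adjacent corners give a triangle. Antipodal neighbours give, through `x`, a
  -- path of length three between two corners of one class.
  no-odd-neighbours : ∀ {v} → HexCycle v → ∀ {x} p {a b} → x ~ v p a → x ~ v (not p) b → ⊥
  no-odd-neighbours hv p {a} {b} xa xb with a Finₚ.≟ b
  ... | no  a≢b  = triangle-free xa (side hv a≢b) (~-sym xb)
  ... | yes refl with two-others a
  ...   | c , _ , c≢a , _ = corner hv {p} c≢a (side hv c≢a) (~-sym xb) xa

  -- The two ends on `w` are antipodal: otherwise the side of `w` between them completes a path of
  -- length three between corners of one class of `v`, or one corner of `v` is adjacent to both
  -- classes of `w`.
  same-index : ∀ {v w} → HexCycle v → HexCycle w → ∀ p q {a a′ b b′} →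
    v p a ~ w q b → v p a′ ~ w (not q) b′ → b ≡ b′
  same-index hv hw p q {a} {a′} {b} {b′} r r′ with a Finₚ.≟ a′ | b Finₚ.≟ b′
  ... | _        | yes b≡b′ = b≡b′
  ... | yes refl | no _     = ⊥-elim (no-odd-neighbours hw q r r′)
  ... | no a≢a′  | no b≢b′  = ⊥-elim (corner hv a≢a′ r (side hw b≢b′) (~-sym r′))

  -- Half of the way around `w` would be a path of length three between two corners of one class of
  -- `v`.
  antipodes-meet : ∀ {v w} → HexCycle v → HexCycle w → ∀ p q {a a′ b} → a ≢ a′ →
    v p a ≡ w q b → v p a′ ≡ w (not q) b → ⊥
  antipodes-meet {v} {w} hv hw p q {a} {a′} {b} a≢a′ eq eq′ with two-others b
  ... | c , d , c≢b , d≢b , c≢d = corner hv a≢a′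
        (subst (_~ w (not q) c) (sym eq) (side hw (c≢b ∘ sym)))
        (~-sym (side hw (c≢d ∘ sym)))
        (subst (w q d ~_) (sym eq′) (side hw d≢b))

  Linked : (v w : Bool → Fin 3 → Fin V) → Bool → Bool → Set
  Linked v w p q = ∃₂ λ a b → v p a ~ w q b

  linked? : ∀ v w p q → Dec (Linked v w p q)
  linked? v w p q = Finₚ.any? λ a → Finₚ.any? λ b → v p a ~? w q b

  -- By `same-index` the four links involve only two indices on each hexagon and form two closed
  -- 4-walks, each with one side of either hexagon. Both walks degenerate, and every combination
  -- identifies antipodal corners of one hexagon with corners of a single class of the other.
  not-all-linked : ∀ {v w} → HexCycle v → HexCycle w →
    Linked v w false false → Linked v w false true → Linked v w true false → Linked v w true true → ⊥
  not-all-linked {v} {w} hv hw (a , b , r₀₀) (a′ , _ , r₀₁) (_ , b′ , r₁₀) (_ , _ , r₁₁)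
    with refl ← same-index hv hw false false r₀₀ r₀₁
       | refl ← same-index hv hw true false r₁₀ r₁₁
       | refl ← same-index hw hv false false (~-sym r₀₀) (~-sym r₁₀)
       | refl ← same-index hw hv true false (~-sym r₀₁) (~-sym r₁₁)
    = final (closed-4-walk (side hv a≢a′) r₁₁ (side hw (b≢b′ ∘ sym)) (~-sym r₀₀))
            (closed-4-walk (side hv (a≢a′ ∘ sym)) r₁₀ (side hw (b≢b′ ∘ sym)) (~-sym r₀₁))
    where
    a≢a′ : a ≢ a′
    a≢a′ refl = no-odd-neighbours hw false r₀₀ r₀₁
    b≢b′ : b ≢ b′
    b≢b′ refl = no-odd-neighbours hv false (~-sym r₀₀) (~-sym r₁₀)
    final : v false a ≡ w true b′ ⊎ v true a′ ≡ w false b →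
            v false a′ ≡ w false b′ ⊎ v true a ≡ w true b → ⊥
    final (inj₁ p) (inj₁ q) = antipodes-meet hv hw false true a≢a′ p q
    final (inj₁ p) (inj₂ q) = antipodes-meet hw hv true false (b≢b′ ∘ sym) (sym p) (sym q)
    final (inj₂ p) (inj₁ q) = antipodes-meet hw hv false true b≢b′ (sym p) (sym q)
    final (inj₂ p) (inj₂ q) = antipodes-meet hv hw true false (a≢a′ ∘ sym) p q

  unlinked-classes : ∀ {v w} → HexCycle v → HexCycle w → ∃₂ λ p q → ∀ a b → ¬ v p a ~ w q b
  unlinked-classes {v} {w} hv hw
    with linked? v w false false | linked? v w false true | linked? v w true false | linked? v w true true
  ... | no n  | _     | _     | _     = false , false , λ a b r → n (a , b , r)
  ... | _     | no n  | _     | _     = false , true  , λ a b r → n (a , b , r)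
  ... | _     | _     | no n  | _     = true  , false , λ a b r → n (a , b , r)
  ... | _     | _     | _     | no n  = true  , true  , λ a b r → n (a , b , r)
  ... | yes p | yes q | yes r | yes s = ⊥-elim (not-all-linked hv hw p q r s)

  unlinked-class : ∀ {v} → HexCycle v → ∀ x → ∃ λ p → ∀ a → ¬ x ~ v p a
  unlinked-class {v} hv x with Finₚ.any? (λ a → x ~? v false a)
  ... | no n        = false , λ a r → n (a , r)
  ... | yes (a , r) = true  , λ b s → no-odd-neighbours hv false r s

  -- Two corners of one class have a common neighbour on the hexagon, so an edge between them would
  -- close a triangle.
  class-independent : ∀ {v} → HexCycle v → ∀ p a b → ¬ v p a ~ v p b
  class-independent hv p a b r with a Finₚ.≟ b
  ... | yes refl = loopless r refl
  ... | no a≢b with other-index a b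
  ...   | c , c≢a , c≢b = triangle-free r (side hv (c≢b ∘ sym)) (~-sym (side hv (c≢a ∘ sym)))

  Independent : (Fin V → Bool) → Set
  Independent S = ∀ {x y} → S x ≡ true → S y ≡ true → ¬ x ~ y

  -- The corners of a hexagonal face.

  module Face (d : Dart V) (hex : FaceLen G d 6) where

    corner-vertex : ℕ → Fin V
    corner-vertex k = vert (iter (φ G) k d)

    -- The odd corners are listed from 3 so that equal indices are three steps apart, that is,
    -- antipodal.
    hexagon : Bool → Fin 3 → Fin V
    hexagon false = lookup (corner-vertex 0 ∷ corner-vertex 2 ∷ corner-vertex 4 ∷ [])
    hexagon true  = lookup (corner-vertex 3 ∷ corner-vertex 5 ∷ corner-vertex 1 ∷ [])

    closes : iter (φ G) 6 d ≡ d
    closes = proj₁ (proj₂ hex)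

    step-adj : ∀ k → corner-vertex k ~ corner-vertex (suc k)
    step-adj k = dart-adj (iter (φ G) k d) refl refl

    last-adj : corner-vertex 5 ~ corner-vertex 0
    last-adj = subst (λ e → corner-vertex 5 ~ vert e) closes (step-adj 5)

    -- Going on for the remaining `l` steps carries a closed orbit of five steps at the `k`-th dart
    -- to one at `d`, against the face length six.
    turn : ∀ k l → l + k ≡ 6 → iter (φ G) 5 (iter (φ G) k d) ≢ iter (φ G) k d
    turn k l l+k≡6 eq = proj₂ (proj₂ hex) 5 (s≤s z≤n) ℕₚ.≤-refl (begin
      iter (φ G) 5 d                                 ≡⟨ cong (iter (φ G) 5) around ⟨
      iter (φ G) 5 (iter (φ G) l (iter (φ G) k d))   ≡⟨ iter-comm (φ G) 5 l (iter (φ G) k d) ⟩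
      iter (φ G) l (iter (φ G) 5 (iter (φ G) k d))   ≡⟨ cong (iter (φ G) l) eq ⟩
      iter (φ G) l (iter (φ G) k d)                  ≡⟨ around ⟩
      d                                              ∎)
      where
      open ≡-Reasoning
      around : iter (φ G) l (iter (φ G) k d) ≡ d
      around = trans (sym (iter-+ (φ G) l k d)) (trans (cong (λ n → iter (φ G) n d) l+k≡6) closes)

    no-path : ∀ k l → l + k ≡ 6 → ∀ {x y} →
      corner-vertex (2 + k) ~ x → x ~ y → y ~ corner-vertex k → ⊥
    no-path k l l+k≡6 = no-pentagon-at (iter (φ G) k d) (turn k l l+k≡6)

    no-path⁻ : ∀ k l → l + k ≡ 6 → ∀ {x y} →
      corner-vertex k ~ x → x ~ y → y ~ corner-vertex (2 + k) → ⊥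
    no-path⁻ k l l+k≡6 r s t = no-path k l l+k≡6 (~-sym t) (~-sym s) (~-sym r)

    wrap : ∀ k → corner-vertex (k + 6) ≡ corner-vertex k
    wrap k = cong vert (trans (iter-+ (φ G) k 6 d) (cong (iter (φ G) k) closes))

    -- Two corners of one class are two steps apart in one of the directions, so `no-path` or its
    -- reverse applies.
    hexCycle : HexCycle hexagon
    hexCycle = record { side = λ {p} → sides p _ _ ; corner = λ {p} → corners p _ _ }
      where
      sides : ∀ p a b → a ≢ b → hexagon p a ~ hexagon (not p) b
      sides p     #0 #0 a≢b = contradiction refl a≢b
      sides p     #1 #1 a≢b = contradiction refl a≢b
      sides p     #2 #2 a≢b = contradiction refl a≢b
      sides false #0 #1 _ = ~-sym last-adj
      sides false #0 #2 _ = step-adj 0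
      sides false #1 #0 _ = step-adj 2
      sides false #1 #2 _ = ~-sym (step-adj 1)
      sides false #2 #0 _ = ~-sym (step-adj 3)
      sides false #2 #1 _ = step-adj 4
      sides true  #0 #1 _ = ~-sym (step-adj 2)
      sides true  #0 #2 _ = step-adj 3
      sides true  #1 #0 _ = last-adj
      sides true  #1 #2 _ = ~-sym (step-adj 4)
      sides true  #2 #0 _ = ~-sym (step-adj 0)
      sides true  #2 #1 _ = step-adj 1
      corners : ∀ p a b {x y} → a ≢ b → hexagon p a ~ x → x ~ y → y ~ hexagon p b → ⊥
      corners p     #0 #0 a≢b = contradiction refl a≢b
      corners p     #1 #1 a≢b = contradiction refl a≢b
      corners p     #2 #2 a≢b = contradiction refl a≢b
      corners false #0 #1 _ = no-path⁻ 0 6 refl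
      corners false #1 #0 _ = no-path 0 6 refl
      corners false #1 #2 _ = no-path⁻ 2 4 refl
      corners false #2 #1 _ = no-path 2 4 refl
      -- Corner 0 is read as corner 6, two steps after corner 4.
      corners false #2 #0 _ r s t = no-path⁻ 4 2 refl r s (subst (_ ~_) (sym (wrap 0)) t)
      corners false #0 #2 _ r = no-path 4 2 refl (subst (_~ _) (sym (wrap 0)) r)
      corners true  #2 #0 _ = no-path⁻ 1 5 refl
      corners true  #0 #2 _ = no-path 1 5 refl
      corners true  #0 #1 _ = no-path⁻ 3 3 refl
      corners true  #1 #0 _ = no-path 3 3 refl
      corners true  #1 #2 _ r s t = no-path⁻ 5 1 refl r s (subst (_ ~_) (sym (wrap 1)) t)
      corners true  #2 #1 _ r = no-path 5 1 refl (subst (_~ _) (sym (wrap 1)) r)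

    odd : ℕ → Bool
    odd zero          = false
    odd (suc zero)    = true
    odd (suc (suc k)) = odd k

    odd-suc : ∀ k → odd (suc k) ≡ not (odd k)
    odd-suc zero          = refl
    odd-suc (suc zero)    = refl
    odd-suc (suc (suc k)) = odd-suc k

    class-of : ∀ k → ∃ λ a → corner-vertex k ≡ hexagon (odd k) a
    class-of 0 = #0 , refl
    class-of 1 = #2 , refl
    class-of 2 = #1 , refl
    class-of 3 = #0 , refl
    class-of 4 = #2 , refl
    class-of 5 = #1 , refl
    -- Six steps return to the same corner and leave the parity unchanged by computation.
    class-of (suc (suc (suc (suc (suc (suc k)))))) with class-of k
    ... | a , eq = a , trans (cong corner-vertex (ℕₚ.+-comm 6 k)) (trans (wrap k) eq)

    -- One of two consecutive corners is in class `p`, hence in `S`; independence keeps the other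
    -- one out.
    alternate : ∀ {S} → Independent S → ∀ p → (∀ a → S (hexagon p a) ≡ true) →
      ∀ k → S (corner-vertex (suc k)) ≢ S (corner-vertex k)
    alternate {S} indep p full k eq with odd k Boolₚ.≟ p
    ... | yes refl with class-of k
    ...   | a , k-a = indep k∈S (trans eq k∈S) (step-adj k)
      where
      k∈S : S (corner-vertex k) ≡ true
      k∈S = trans (cong S k-a) (full a)
    alternate {S} indep p full k eq | no k≢p with class-of (suc k)
    ... | a , k-a = indep (trans (sym eq) k∈S) k∈S (step-adj k)
      where
      k∈S : S (corner-vertex (suc k)) ≡ true
      k∈S = trans (cong S (trans k-a (cong (λ q → hexagon q a) (trans (odd-suc k) (sym (Boolₚ.¬-not (k≢p ∘ sym)))))))
                  (full a)

-- Perfect matchings of the leapfrog graph.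

module Leapfrog {V : ℕ} (G : CubicMap V) (isMap : IsMap G) (simple : Simple G)
  (3-conn : ThreeConnected G) (plane : Plane G)
  (faces : ∀ d → FaceLen G d 5 ⊎ FaceLen G d 6) where
  open CubicMap G
  open Girth G isMap simple 3-conn plane faces
  open DecMembership (Finₚ._≟_ {V}) using (_∈?_)

  L : CubicMap (V * 3)
  L = leapfrog G

  dec-enc : ∀ d → dec G (enc G d) ≡ d
  dec-enc (v , i) = Finₚ.remQuot-combine v i

  enc-dec : ∀ x → enc G (dec G x) ≡ x
  enc-dec x = Finₚ.combine-remQuot {V} 3 x

  αα : ∀ d → α (α d) ≡ d
  αα = proj₁ isMap

  vert-αφ⁻ : ∀ d → vert (α (φ⁻ G d)) ≡ vert d
  vert-αφ⁻ d = cong vert (αα (σ⁻ G d))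

  -- Start from the matching of all edges of G and flip the hexagons around the vertices of S.
  in-flipped : (Fin V → Bool) → Dart V → Fin 3 → Bool
  in-flipped S d #0 = not (S (vert d)) ∧ not (S (vert (α d)))
  in-flipped S d #1 = S (vert d)
  in-flipped S d #2 = S (vert (α d))

  flipped : (Fin V → Bool) → Dart (V * 3) → Bool
  flipped S (x , i) = in-flipped S (dec G x) i

  flipped-enc : ∀ S d i → flipped S (enc G d , i) ≡ in-flipped S d i
  flipped-enc S d i = cong (λ e → in-flipped S e i) (dec-enc d)

  flipped-α : ∀ S D → flipped S (leapα G D) ≡ flipped S D
  flipped-α S (x , #0) = begin
    flipped S (enc G (α d) , #0)                         ≡⟨ flipped-enc S (α d) #0 ⟩
    not (S (vert (α d))) ∧ not (S (vert (α (α d))))       ≡⟨ cong (λ e → not (S (vert (α d))) ∧ not (S (vert e))) (αα d) ⟩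
    not (S (vert (α d))) ∧ not (S (vert d))               ≡⟨ Boolₚ.∧-comm (not (S (vert (α d)))) (not (S (vert d))) ⟩
    not (S (vert d)) ∧ not (S (vert (α d)))               ∎
    where
    open ≡-Reasoning
    d = dec G x
  flipped-α S (x , #1) = trans (flipped-enc S (φ⁻ G (dec G x)) #2) (cong S (vert-αφ⁻ (dec G x)))
  flipped-α S (x , #2) = flipped-enc S (φ G (dec G x)) #1

  -- Independence leaves at most one end of each dart of `G` in `S`. The tail in `S` selects index
  -- 1, the head index 2, and neither selects the original edge.
  flipped-perfect : ∀ {S} → Independent S → PerfectMatching L (flipped S)
  flipped-perfect {S} indep = flipped-α S , λ x → cover x refl refl
    where
    cover : ∀ x {p q} → S (vert (dec G x)) ≡ p → S (vert (α (dec G x))) ≡ q →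
      ∃ λ i → flipped S (x , i) ≡ true × (∀ j → j ≢ i → flipped S (x , j) ≡ false)
    cover x {true} {true} p q = contradiction (dart-adj (dec G x) refl refl) (indep p q)
    cover x {true} {false} p q = #1 , p , λ
      { #0 _ → cong (λ b → not b ∧ not (S (vert (α (dec G x))))) p ; #1 j≢i → contradiction refl j≢i ; #2 _ → q }
    cover x {false} {true} p q = #2 , q , λ
      { #0 _ → trans (cong (λ b → not (S (vert (dec G x))) ∧ not b) q)
                     (Boolₚ.∧-zeroʳ (not (S (vert (dec G x)))))
      ; #1 _ → p ; #2 j≢i → contradiction refl j≢i }
    cover x {false} {false} p q = #0 , cong₂ (λ a b → not a ∧ not b) p q , λ
      { #0 j≢i → contradiction refl j≢i ; #1 _ → p ; #2 _ → q }

  -- Face tracing in the leapfrog alternates indices 0 and 1 around a vertex of `G`, the head of the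
  -- dart for 0 and its tail for 1. Index 2 is preserved and follows a face of `G`, hence the empty
  -- case.
  On : Fin V → Dart V → Fin 3 → Set
  On u d #0 = vert (α d) ≡ u
  On u d #1 = vert d ≡ u
  On u d #2 = ⊥

  Around : Fin V → Dart (V * 3) → Set
  Around u (x , i) = On u (dec G x) i

  around-enc : ∀ {u} d i → On u d i → Around u (enc G d , i)
  around-enc {u} d i = subst (λ e → On u e i) (sym (dec-enc d))

  around-φ : ∀ {u} D → Around u D → Around u (φ L D)
  around-φ (x , #0) eq = around-enc (α (dec G x)) #1 eq
  around-φ (x , #1) eq = around-enc (φ⁻ G (dec G x)) #0 (trans (vert-αφ⁻ (dec G x)) eq)
  around-φ (x , #2) ()

  around-iter : ∀ {u D} → Around u D → ∀ k → Around u (iter (φ L) k D)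
  around-iter around zero    = around
  around-iter around (suc k) = around-φ _ (around-iter around k)

  -- The hexagon around `u` is itself flipped, or nothing is flipped at all. In both cases the edges
  -- of `G` at `u` and the other edges of that hexagon have opposite status.
  Switchable : (Fin V → Bool) → Fin V → Set
  Switchable S u = S u ≡ true ⊎ (∀ v → S v ≡ false)

  not-∧-switch : ∀ {S u} v → Switchable S u → not (S v) ∧ not (S u) ≢ S u
  not-∧-switch {S} v (inj₁ u∈S) rewrite u∈S | Boolₚ.∧-zeroʳ (not (S v)) = λ ()
  not-∧-switch {S} {u} v (inj₂ empty) rewrite empty u | empty v = λ ()

  around-alternating : ∀ {S u D} → Around u D → Switchable S u → Alternating L (flipped S) D
  around-alternating {S} {u} {D} around switch k = one (iter (φ L) k D) (around-iter around k)
    where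
    one : ∀ D → Around u D → flipped S (φ L D) ≢ flipped S D
    one (x , #0) refl eq = not-∧-switch (vert (dec G x)) switch
      (trans (sym eq) (flipped-enc S (α (dec G x)) #1))
    one (x , #1) refl eq = not-∧-switch (vert (φ⁻ G d)) switch
      (trans (cong (λ v → not (S (vert (φ⁻ G d))) ∧ not (S v)) (sym (vert-αφ⁻ d)))
             (trans (sym (flipped-enc S (φ⁻ G d) #0)) eq))
      where d = dec G x
    one (x , #2) ()

  face-orbit : ∀ k x → iter (φ L) k (x , #2) ≡ (enc G (iter (φ G) k (dec G x)) , #2)
  face-orbit zero    x = cong (_, #2) (sym (enc-dec x))
  face-orbit (suc k) x = trans (cong (φ L) (face-orbit k x))
                               (cong (λ d → enc G (φ G d) , #2) (dec-enc (iter (φ G) k (dec G x))))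

  face-hexagon : ∀ {x} → FaceLen L (x , #2) 6 → FaceLen G (dec G x) 6
  face-hexagon {x} (0<6 , closes , least) = 0<6
    , trans (sym (dec-enc _)) (cong (dec G ∘ proj₁) (trans (sym (face-orbit 6 x)) closes))
    , λ j 0<j j<6 eq → least j 0<j j<6
        (trans (face-orbit j x) (cong (_, #2) (trans (cong (enc G) eq) (enc-dec x))))

  face-alternating : ∀ {S x} →
    (∀ k → S (vert (iter (φ G) (suc k) (dec G x))) ≢ S (vert (iter (φ G) k (dec G x)))) →
    Alternating L (flipped S) (x , #2)
  -- Index 2 reads `S` at the head of the dart, which is the next corner; hence the shift by one.
  face-alternating {S} {x} alt k eq = alt (suc k) (trans (sym (value (suc k))) (trans eq (value k)))
    where
    value : ∀ k → flipped S (iter (φ L) k (x , #2)) ≡ S (vert (iter (φ G) (suc k) (dec G x)))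
    value k = trans (cong (flipped S) (face-orbit k x)) (flipped-enc S (iter (φ G) k (dec G x)) #2)

  membership : List (Fin V) → Fin V → Bool
  membership xs u = does (u ∈? xs)

  member : ∀ {xs u} → u ∈ xs → membership xs u ≡ true
  member {xs} {u} = dec-true (u ∈? xs)

  membership⁻ : ∀ xs {u} → membership xs u ≡ true → u ∈ xs
  membership⁻ xs {u} eq with u ∈? xs
  ... | yes u∈xs = u∈xs

  union-independent : ∀ {m n} (f : Fin m → Fin V) (g : Fin n → Fin V) →
    (∀ i j → ¬ f i ~ f j) → (∀ i j → ¬ g i ~ g j) → (∀ i j → ¬ f i ~ g j) →
    Independent (membership (List.tabulate f ++ List.tabulate g))
  union-independent f g ff gg fg {x} {y} x∈ y∈
    with ∈-++⁻ (List.tabulate f) (membership⁻ (List.tabulate f ++ List.tabulate g) x∈)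
       | ∈-++⁻ (List.tabulate f) (membership⁻ (List.tabulate f ++ List.tabulate g) y∈)
  ... | inj₁ p | inj₁ q with ∈-tabulate⁻ p | ∈-tabulate⁻ q
  ...   | i , refl | j , refl = ff i j
  union-independent f g ff gg fg x∈ y∈ | inj₁ p | inj₂ q with ∈-tabulate⁻ p | ∈-tabulate⁻ q
  ...   | i , refl | j , refl = fg i j
  union-independent f g ff gg fg x∈ y∈ | inj₂ p | inj₁ q with ∈-tabulate⁻ p | ∈-tabulate⁻ q
  ...   | i , refl | j , refl = fg j i ∘ ~-sym
  union-independent f g ff gg fg x∈ y∈ | inj₂ p | inj₂ q with ∈-tabulate⁻ p | ∈-tabulate⁻ q
  ...   | i , refl | j , refl = gg i j

  left-member : ∀ {m n} (f : Fin m → Fin V) (g : Fin n → Fin V) i →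
    membership (List.tabulate f ++ List.tabulate g) (f i) ≡ true
  left-member f g i = member (∈-++⁺ˡ (∈-tabulate⁺ i))

  right-member : ∀ {m n} (f : Fin m → Fin V) (g : Fin n → Fin V) i →
    membership (List.tabulate f ++ List.tabulate g) (g i) ≡ true
  right-member f g i = member (∈-++⁺ʳ (List.tabulate f) (∈-tabulate⁺ i))

  -- Pairs of hexagons, each around a vertex or from a face of the original graph.

  data Kind : Dart (V * 3) → Set where
    at-vertex : ∀ {D} u → Around u D → Kind D
    at-face   : ∀ x → Kind (x , #2)

  kind : ∀ D → Kind D
  kind (x , #0) = at-vertex (vert (α (dec G x))) refl
  kind (x , #1) = at-vertex (vert (dec G x)) refl
  kind (x , #2) = at-face x

  BothAlternating : (D E : Dart (V * 3)) → Set
  BothAlternating D E = ∃ λ M → PerfectMatching L M × Alternating L M D × Alternating L M E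

  -- The vertices to flip are `u` and the class of alternate corners of the face that has no
  -- neighbour of `u`.
  vertex-face : ∀ {u D x} → Around u D → FaceLen L (x , #2) 6 → BothAlternating D (x , #2)
  vertex-face {u} {D} {x} around hex = build (unlinked-class hexCycle u)
    where
    open Face (dec G x) (face-hexagon hex)
    build : (∃ λ p → ∀ a → ¬ u ~ hexagon p a) → BothAlternating D (x , #2)
    build (p , free) = flipped S , flipped-perfect indep
      , around-alternating around (inj₁ (left-member f g #0))
      , face-alternating (alternate {S} indep p (right-member f g))
      where
      f : Fin 1 → Fin V
      f _ = u
      g = hexagon p
      S = membership (List.tabulate f ++ List.tabulate g)
      indep : Independent S
      indep = union-independent f g (λ _ _ r → loopless r refl) (class-independent hexCycle p) (λ _ → free)

  -- Flipping at the union of two unlinked classes makes both faces alternate.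
  face-face : ∀ {x y} → FaceLen L (x , #2) 6 → FaceLen L (y , #2) 6 → BothAlternating (x , #2) (y , #2)
  face-face {x} {y} hex hex′ = build (unlinked-classes X.hexCycle Y.hexCycle)
    where
    module X = Face (dec G x) (face-hexagon hex)
    module Y = Face (dec G y) (face-hexagon hex′)
    build : (∃₂ λ p q → ∀ a b → ¬ X.hexagon p a ~ Y.hexagon q b) → BothAlternating (x , #2) (y , #2)
    build (p , q , free) = flipped S , flipped-perfect indep
      , face-alternating (X.alternate {S} indep p (left-member f g))
      , face-alternating (Y.alternate {S} indep q (right-member f g))
      where
      f = X.hexagon p
      g = Y.hexagon q
      S = membership (List.tabulate f ++ List.tabulate g)
      indep : Independent S
      indep = union-independent f g (class-independent X.hexCycle p) (class-independent Y.hexCycle q) free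

  swap-both : ∀ {D E} → BothAlternating D E → BothAlternating E D
  swap-both (M , perfect , alt , alt′) = M , perfect , alt′ , alt

  by-kind : ∀ {D E} → Kind D → Kind E → Hexagon L D → Hexagon L E → BothAlternating D E
  by-kind (at-vertex _ around) (at-vertex _ around′) hex hex′ =
    -- With nothing flipped, the edges of `G` alternate on every hexagon around a vertex.
    flipped (λ _ → false) , flipped-perfect (λ ())
      , around-alternating around (inj₂ λ _ → refl) , around-alternating around′ (inj₂ λ _ → refl)
  by-kind (at-vertex _ around) (at-face _) hex hex′ = vertex-face around hex′
  by-kind (at-face _) (at-vertex _ around) hex hex′ = swap-both (vertex-face around hex)
  by-kind (at-face _) (at-face _) hex hex′ = face-face hex hex′

  two-hexagons : ∀ D E → Hexagon L D → Hexagon L E → BothAlternating D E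
  two-hexagons D E = by-kind (kind D) (kind E)

  first-resonant : ∀ {D E} → BothAlternating D E → ResonantPattern L (D ∷ [])
  first-resonant (M , perfect , alt , _) = M , perfect , alt ∷ []

  both-resonant : ∀ {D E} → BothAlternating D E → ResonantPattern L (D ∷ E ∷ [])
  both-resonant (M , perfect , alt , alt′) = M , perfect , alt ∷ alt′ ∷ []

  2-resonant : KResonant L 2
  2-resonant [] _ _ _ = flipped (λ _ → false) , flipped-perfect (λ ()) , []
  -- A single hexagon is paired with itself.
  2-resonant (D ∷ []) _ (hex ∷ []) _ = first-resonant (two-hexagons D D hex hex)
  2-resonant (D ∷ E ∷ []) _ (hex ∷ hex′ ∷ []) _ = both-resonant (two-hexagons D E hex hex′)
  2-resonant (_ ∷ _ ∷ _ ∷ _) (s≤s (s≤s ()))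

theorem3p2 : ∀ {V} (G : CubicMap V) → Fullerene G → KResonant (leapfrog G) 2
theorem3p2 G (isMap , simple , 3-conn , plane , faces , _) =
  Leapfrog.2-resonant G isMap simple 3-conn plane faces
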